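{- Let $G=\langle V,E\rangle$ be a finite directed graph in which every node has out-degree at least $1$, let $s\in V$ and $\alpha\in[0,1)$. Then for every integer $j\ge 0$, the residue vector $\vec{r_s}^{(j+1)}$ and the underestimate PPR vector $\hat{\pi_s}^{(j+1)}$ obtained by Simultaneous Forward Push (SimFwdPush) in its $(j+1)$-th iteration are exactly equal to the vectors $\vec{\gamma_s}^{(j+1)}$ and $\vec{\pi}_s^{(j+1)}$, respectively, computed in the $(j+1)$-th iteration of Power Iteration (PowItr).
   Context: Let $V=\{v_1,\dots,v_n\}$; for $v\in V$, $N_{out}(v)=\{u:(v,u)\in E\}$ and $d_v=|N_{out}(v)|$. Vectors are row vectors in $\mathbb{R}^{1\times n}$ indexed by nodes; $\vec{e_s}$ is the indicator vector of $s$. The transition matrix $\mathbf{P}\in\mathbb{R}^{n\times n}$ has entry $\frac{1}{d_{v}}$ in row $v$ and column $u$ if $(v,u)\in E$, and $0$ otherwise. Power Iteration (PowItr): $\vec{\gamma_s}^{(0)}=\vec{e_s}$, $\vec{\pi}_s^{(0)}=\vec 0$, and in the $(j+1)$-th iteration ($j=0,1,2,\dots$) $$\vec{\gamma_s}^{(j+1)}=(1-\alpha)\cdot\vec{\gamma_s}^{(j)}\cdot\mathbf{P},\qquad \vec{\pi}_s^{(j+1)}=\sum_{k=0}^{j}\alpha\cdot\vec{\gamma_s}^{(k)}.$$ Simultaneous Forward Push (SimFwdPush) maintains for each node $v$ a residue $r^{(j)}(s,v)$ and a reserve $\hat\pi^{(j)}(s,v)$ (its values at the beginning of iteration $j+1$),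 collected in the vectors $\vec{r_s}^{(j)}$ and $\hat{\pi_s}^{(j)}$. Initially $\vec{r_s}^{(0)}=\vec{e_s}$ and $\hat{\pi_s}^{(0)}=\vec 0$. A node $v$ is active in iteration $j+1$ if $r^{(j)}(s,v)\neq 0$. In iteration $j+1$ a push operation is performed simultaneously on all active nodes, based on the residues $r^{(j)}(s,\cdot)$: each active $v$ adds $\alpha\cdot r^{(j)}(s,v)$ to its reserve, gives up its whole residue $r^{(j)}(s,v)$, and contributes $\frac{(1-\alpha)\cdot r^{(j)}(s,v)}{d_v}$ to the new residue of each $u\in N_{out}(v)$; thus $r^{(j+1)}(s,u)$ is the sum of the contributions received by $u$ in iteration $j+1$. For this statement the iterations of both procedures are considered to continue indefinitely (stopping rules are ignored). -}

module Defs where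

import Algebra.Definitions.RawMonoid as RawMonoidSum
import Algebra.Properties.CommutativeSemigroup as CommutativeSemigroup
open import Algebra.Bundles using (RawMonoid; CommutativeMonoid)
open import Data.Bool using (Bool; _∧_; if_then_else_)
open import Data.Fin using (Fin; toℕ)
import Data.Fin.Properties as Fin
open import Data.Fin.Subset using (Subset; ∣_∣)
open import Data.Integer using (+_)
open import Data.Nat as ℕ using (ℕ; zero; suc; NonZero; >-nonZero)
import Data.Nat.Properties as ℕ
open import Data.Product using (∃; _×_; _,_)
open import Data.Rational as ℚ using (ℚ; 0ℚ; 1ℚ; ½)
import Data.Rational.Properties as ℚ
open import Data.Vec using (tabulate)
open import Data.Vec.Functional using (Vector)
open import Effect.Monad using (RawMonad)
open import Level using (0ℓ)
open import Relation.Binary.PropositionalEquality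
open import Relation.Nullary using (¬_; Dec; does)
open import Relation.Nullary.Decidable using (¬¬-excluded-middle)
open import Relation.Nullary.Negation using (¬¬-Monad)

------------------------------------------------------------------------
-- Real numbers: Cauchy sequences of rationals, compared by the setoid
-- equality _≃_ ("the difference tends to 0").  Classically these are the
-- usual reals.

Eventually : (ℕ → Set) → Set
Eventually P = ∃ λ N → ∀ n → N ℕ.≤ n → P n

IsCauchy : (ℕ → ℚ) → Set
IsCauchy x = ∀ ε → 0ℚ ℚ.< ε →
  ∃ λ N → ∀ m n → N ℕ.≤ m → N ℕ.≤ n → ℚ.∣ x m ℚ.- x n ∣ ℚ.< ε

record ℝ : Set where
  constructor _,ᶜ_
  field
    seq    : ℕ → ℚ
    cauchy : IsCauchy seq

open ℝ public

infix 4 _≃_ _≤_ _<_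

_≃_ _≤_ _<_ : ℝ → ℝ → Set
x ≃ y = ∀ ε → 0ℚ ℚ.< ε → Eventually λ n → ℚ.∣ seq x n ℚ.- seq y n ∣ ℚ.< ε
x ≤ y = ∀ ε → 0ℚ ℚ.< ε → Eventually λ n → seq x n ℚ.< seq y n ℚ.+ ε
x < y = ∃ λ ε → 0ℚ ℚ.< ε × Eventually λ n → seq x n ℚ.+ ε ℚ.< seq y n

private
  open CommutativeSemigroup
    (CommutativeMonoid.commutativeSemigroup ℚ.+-0-commutativeMonoid)
    using (interchange)

  half-pos : ∀ {ε} → 0ℚ ℚ.< ε → 0ℚ ℚ.< ½ ℚ.* ε
  half-pos {ε} ε>0 =
    subst (ℚ._< ½ ℚ.* ε) (ℚ.*-zeroʳ ½) (ℚ.*-monoʳ-<-pos ½ ε>0)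

  halves : ∀ ε → ½ ℚ.* ε ℚ.+ ½ ℚ.* ε ≡ ε
  halves ε = trans (sym (ℚ.*-distribʳ-+ ε ½ ½)) (ℚ.*-identityˡ ε)

  split : ∀ a b → a ≡ (a ℚ.- b) ℚ.+ b
  split a b = sym (trans (ℚ.+-assoc a (ℚ.- b) b)
                  (trans (cong (a ℚ.+_) (ℚ.+-inverseˡ b)) (ℚ.+-identityʳ a)))

  telescope : ∀ p q r → (p ℚ.- q) ℚ.+ (q ℚ.- r) ≡ p ℚ.- r
  telescope p q r = trans (sym (ℚ.+-assoc (p ℚ.- q) q (ℚ.- r)))
                          (cong (ℚ._- r) (sym (split p q)))

  *-distribˡ-- : ∀ p q r → p ℚ.* (q ℚ.- r) ≡ p ℚ.* q ℚ.- p ℚ.* r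
  *-distribˡ-- p q r = trans (ℚ.*-distribˡ-+ p q (ℚ.- r))
    (cong (p ℚ.* q ℚ.+_) (sym (ℚ.neg-distribʳ-* p r)))

  sum-difference : ∀ a b c d → (a ℚ.+ b) ℚ.- (c ℚ.+ d) ≡ (a ℚ.- c) ℚ.+ (b ℚ.- d)
  sum-difference a b c d =
    trans (cong (a ℚ.+ b ℚ.+_) (ℚ.neg-distrib-+ c d))
          (interchange a b (ℚ.- c) (ℚ.- d))

  product-difference : ∀ a b c d →
    a ℚ.* b ℚ.- c ℚ.* d ≡ a ℚ.* (b ℚ.- d) ℚ.+ d ℚ.* (a ℚ.- c)
  product-difference a b c d = sym (trans
    (cong₂ ℚ._+_ (*-distribˡ-- a b d)
      (trans (*-distribˡ-- d a c)
             (cong₂ ℚ._-_ (ℚ.*-comm d a) (ℚ.*-comm d c))))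
    (telescope (a ℚ.* b) (a ℚ.* d) (c ℚ.* d)))

  +-near : ∀ p q {ε} → ℚ.∣ p ∣ ℚ.< ½ ℚ.* ε → ℚ.∣ q ∣ ℚ.< ½ ℚ.* ε →
           ℚ.∣ p ℚ.+ q ∣ ℚ.< ε
  +-near p q {ε} p< q< = subst (ℚ.∣ p ℚ.+ q ∣ ℚ.<_) (halves ε)
    (ℚ.≤-<-trans (ℚ.∣p+q∣≤∣p∣+∣q∣ p q) (ℚ.+-mono-< p< q<))

  *-near : ∀ a b {B δ η} → ℚ.Positive B → B ℚ.* δ ≡ η →
           ℚ.∣ a ∣ ℚ.≤ B → ℚ.∣ b ∣ ℚ.< δ → ℚ.∣ a ℚ.* b ∣ ℚ.< η
  *-near a b {B} B>0 refl a≤B b<δ = subst (ℚ._< _) (sym (ℚ.∣p*q∣≡∣p∣*∣q∣ a b))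
    (ℚ.≤-<-trans (ℚ.*-monoʳ-≤-nonNeg ℚ.∣ b ∣ {{ℚ.∣-∣-nonNeg b}} a≤B)
                 (ℚ.*-monoʳ-<-pos B {{B>0}} b<δ))

  0<1 : 0ℚ ℚ.< 1ℚ
  0<1 = ℚ.positive⁻¹ 1ℚ

  bounded : ∀ x → IsCauchy x →
    ∃ λ B → ℚ.Positive B × Eventually λ n → ℚ.∣ x n ∣ ℚ.≤ B
  bounded x cx with N , near ← cx 1ℚ 0<1 =
    1ℚ ℚ.+ ℚ.∣ x N ∣ ,
    ℚ.positive (ℚ.+-mono-<-≤ 0<1 (ℚ.0≤∣p∣ (x N))) ,
    N , λ n n≥ → subst (λ a → ℚ.∣ a ∣ ℚ.≤ 1ℚ ℚ.+ ℚ.∣ x N ∣) (sym (split (x n) (x N)))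
      (ℚ.≤-trans (ℚ.∣p+q∣≤∣p∣+∣q∣ (x n ℚ.- x N) (x N))
                 (ℚ.+-monoˡ-≤ ℚ.∣ x N ∣ (ℚ.<⇒≤ (near n N n≥ ℕ.≤-refl))))

  divide-pos : ∀ B → ℚ.Positive B → ∀ {ε} → 0ℚ ℚ.< ε →
    ∃ λ δ → 0ℚ ℚ.< δ × B ℚ.* δ ≡ ε
  divide-pos B B>0 {ε} ε>0 = B⁻¹ ℚ.* ε , δ>0 , eq
    where
    instance
      _ = B>0
      _ = ℚ.pos⇒nonZero B
    B⁻¹ = ℚ.1/ B
    instance
      _ = ℚ.1/pos⇒pos B
    δ>0 : 0ℚ ℚ.< B⁻¹ ℚ.* ε
    δ>0 = subst (ℚ._< B⁻¹ ℚ.* ε) (ℚ.*-zeroʳ B⁻¹) (ℚ.*-monoʳ-<-pos B⁻¹ ε>0)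
    eq : B ℚ.* (B⁻¹ ℚ.* ε) ≡ ε
    eq = trans (sym (ℚ.*-assoc B B⁻¹ ε))
        (trans (cong (ℚ._* ε) (ℚ.*-inverseʳ B)) (ℚ.*-identityˡ ε))

abstract
  neg-cauchy : ∀ x → IsCauchy x → IsCauchy (λ n → ℚ.- x n)
  neg-cauchy x cx ε ε>0 with N , near ← cx ε ε>0 =
    N , λ m n m≥ n≥ → subst (ℚ._< ε) (sym (same (x m) (x n))) (near m n m≥ n≥)
    where
    same : ∀ a b → ℚ.∣ ℚ.- a ℚ.- ℚ.- b ∣ ≡ ℚ.∣ a ℚ.- b ∣
    same a b = trans (cong ℚ.∣_∣ (sym (ℚ.neg-distrib-+ a (ℚ.- b)))) (ℚ.∣-p∣≡∣p∣ (a ℚ.- b))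

  +-cauchy : ∀ x y → IsCauchy x → IsCauchy y → IsCauchy (λ n → x n ℚ.+ y n)
  +-cauchy x y cx cy ε ε>0 =
    let N₁ , near-x = cx (½ ℚ.* ε) (half-pos ε>0)
        N₂ , near-y = cy (½ ℚ.* ε) (half-pos ε>0)
    in N₁ ℕ.⊔ N₂ , λ m n m≥ n≥ →
      subst (λ a → ℚ.∣ a ∣ ℚ.< ε) (sym (sum-difference (x m) (y m) (x n) (y n)))
        (+-near (x m ℚ.- x n) (y m ℚ.- y n)
          (near-x m n (ℕ.m⊔n≤o⇒m≤o N₁ N₂ m≥) (ℕ.m⊔n≤o⇒m≤o N₁ N₂ n≥))
          (near-y m n (ℕ.m⊔n≤o⇒n≤o N₁ N₂ m≥) (ℕ.m⊔n≤o⇒n≤o N₁ N₂ n≥)))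

  *-cauchy : ∀ x y → IsCauchy x → IsCauchy y → IsCauchy (λ n → x n ℚ.* y n)
  *-cauchy x y cx cy ε ε>0 =
    let Bx , Bx>0 , N₁ , x≤ = bounded x cx
        By , By>0 , N₂ , y≤ = bounded y cy
        δy , δy>0 , eqy = divide-pos Bx Bx>0 (half-pos ε>0)
        δx , δx>0 , eqx = divide-pos By By>0 (half-pos ε>0)
        N₃ , near-x = cx δx δx>0
        N₄ , near-y = cy δy δy>0
        N₁₂ = N₁ ℕ.⊔ N₂
        N₃₄ = N₃ ℕ.⊔ N₄
    in N₁₂ ℕ.⊔ N₃₄ , λ m n m≥ n≥ →
      let m₁₂ = ℕ.m⊔n≤o⇒m≤o N₁₂ N₃₄ m≥
          n₁₂ = ℕ.m⊔n≤o⇒m≤o N₁₂ N₃₄ n≥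
          m₃₄ = ℕ.m⊔n≤o⇒n≤o N₁₂ N₃₄ m≥
          n₃₄ = ℕ.m⊔n≤o⇒n≤o N₁₂ N₃₄ n≥
      in subst (λ a → ℚ.∣ a ∣ ℚ.< ε) (sym (product-difference (x m) (y m) (x n) (y n)))
        (+-near (x m ℚ.* (y m ℚ.- y n)) (y n ℚ.* (x m ℚ.- x n))
          (*-near (x m) (y m ℚ.- y n) Bx>0 eqy
            (x≤ m (ℕ.m⊔n≤o⇒m≤o N₁ N₂ m₁₂))
            (near-y m n (ℕ.m⊔n≤o⇒n≤o N₃ N₄ m₃₄) (ℕ.m⊔n≤o⇒n≤o N₃ N₄ n₃₄)))
          (*-near (y n) (x m ℚ.- x n) By>0 eqx
            (y≤ n (ℕ.m⊔n≤o⇒n≤o N₁ N₂ n₁₂))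
            (near-x m n (ℕ.m⊔n≤o⇒m≤o N₃ N₄ m₃₄) (ℕ.m⊔n≤o⇒m≤o N₃ N₄ n₃₄))))

fromℚ : ℚ → ℝ
fromℚ q = (λ _ → q) ,ᶜ λ ε ε>0 →
  0 , λ _ _ _ _ → subst (ℚ._< ε) (sym (cong ℚ.∣_∣ (ℚ.+-inverseʳ q))) ε>0

0ℝ 1ℝ : ℝ
0ℝ = fromℚ 0ℚ
1ℝ = fromℚ 1ℚ

infixl 6 _+_ _-_
infixl 7 _*_ _/_

_+_ _-_ _*_ : ℝ → ℝ → ℝ
x + y = (λ n → seq x n ℚ.+ seq y n) ,ᶜ
        +-cauchy (seq x) (seq y) (cauchy x) (cauchy y)
x - y = (λ n → seq x n ℚ.- seq y n) ,ᶜ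
        +-cauchy (seq x) (λ n → ℚ.- seq y n)
          (cauchy x) (neg-cauchy (seq y) (cauchy y))
x * y = (λ n → seq x n ℚ.* seq y n) ,ᶜ
        *-cauchy (seq x) (seq y) (cauchy x) (cauchy y)

_/_ : ℝ → (d : ℕ) .{{_ : NonZero d}} → ℝ
x / d = x * fromℚ (+ 1 ℚ./ d)

+-rawMonoid : RawMonoid 0ℓ 0ℓ
+-rawMonoid = record { Carrier = ℝ ; _≈_ = _≃_ ; _∙_ = _+_ ; ε = 0ℝ }

open RawMonoidSum +-rawMonoid using (sum) public

------------------------------------------------------------------------
-- Row vectors and matrices

infix  4 _≈ᵥ_
infixl 7 _·ᵥ_ _ᵥ·ₘ_

_≈ᵥ_ : ∀ {n} → Vector ℝ n → Vector ℝ n → Set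
x ≈ᵥ y = ∀ i → x i ≃ y i

_·ᵥ_ : ∀ {n} → ℝ → Vector ℝ n → Vector ℝ n
(c ·ᵥ x) i = c * x i

-- A i j is the entry in row i and column j.
Matrix : ℕ → Set
Matrix n = Fin n → Fin n → ℝ

_ᵥ·ₘ_ : ∀ {n} → Vector ℝ n → Matrix n → Vector ℝ n
(x ᵥ·ₘ A) j = sum λ i → x i * A i j

indicator : ∀ {n} → Fin n → Vector ℝ n
indicator s v = if does (v Fin.≟ s) then 1ℝ else 0ℝ

------------------------------------------------------------------------
-- Directed graphs (self-loops allowed, no parallel edges)

record Digraph (n : ℕ) : Set where
  field
    edge : Fin n → Fin n → Bool

  N-out : Fin n → Subset n
  N-out v = tabulate (edge v)

  outDegree : Fin n → ℕ
  outDegree v = ∣ N-out v ∣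

------------------------------------------------------------------------
-- The two procedures

module PPR {n : ℕ} (G : Digraph n)
           (deg≥1 : ∀ v → 1 ℕ.≤ Digraph.outDegree G v)
           (s : Fin n) (α : ℝ) where

  open Digraph G

  private instance
    outDegree-nonZero : ∀ {v} → NonZero (outDegree v)
    outDegree-nonZero {v} = >-nonZero (deg≥1 v)

  P : Matrix n
  P v u = if edge v u then 1ℝ / outDegree v else 0ℝ

  γ : ℕ → Vector ℝ n
  γ zero    = indicator s
  γ (suc j) = (1ℝ - α) ·ᵥ γ j ᵥ·ₘ P

  π : ℕ → Vector ℝ n
  π zero    v = 0ℝ
  π (suc j) v = sum {suc j} λ k → α * γ (toℕ k) v

  record State : Set where
    field
      residue : Vector ℝ n
      reserve : Vector ℝ n

  open State public

  start : State
  start = record { residue = indicator s ; reserve = λ _ → 0ℝ }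

  Active : State → Fin n → Set
  Active σ v = ¬ (residue σ v ≃ 0ℝ)

  -- An inactive node keeps no residue of its own either: its residue is
  -- already 0, so the new residue consists of received contributions only.
  pushActive : (σ : State) → (∀ v → Dec (Active σ v)) → State
  pushActive σ active? = record
    { residue = λ u → sum λ v →
        if does (active? v) ∧ edge v u
        then ((1ℝ - α) * residue σ v) / outDegree v
        else 0ℝ
    ; reserve = λ v →
        if does (active? v)
        then reserve σ v + α * residue σ v
        else reserve σ v
    }

  -- SimFwdPush j σ: σ is the state after j iterations.  This is a relation,
  -- not a function of j, because equality with 0 is not decidable
  -- constructively; each iteration carries the decision of which nodes are
  -- active.
  data SimFwdPush : ℕ → State → Set where
    initially : SimFwdPush zero start
    iterate   : ∀ {j σ} → SimFwdPush j σ →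
                (active? : ∀ v → Dec (Active σ v)) →
                SimFwdPush (suc j) (pushActive σ active?)

  -- Classically, a state after j iterations always exists.
  SimFwdPush-runs : ∀ j → ¬ ¬ ∃ (SimFwdPush j)
  SimFwdPush-runs zero    = λ none → none (start , initially)
  SimFwdPush-runs (suc j) = do
    σ , run ← SimFwdPush-runs j
    active? ← Fin.sequence rawApplicative {P = λ v → Dec (Active σ v)}
                (λ _ → ¬¬-excluded-middle)
    pure (pushActive σ active? , iterate run active?)
    where open RawMonad ¬¬-Monad

{-# OPTIONS --safe #-}
-- Pushing an inactive node would contribute 0, because ≃ is stable under
-- double negation and so an inactive node has residue ≃ 0.  Hence a simultaneous
-- push is the linear map r ↦ (1 − α) r P on residues and adds α r to the reserves.
module Submission where

open import Defs
open import Algebra.Bundles using (Monoid; CommutativeMonoid)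
import Algebra.Properties.AbelianGroup as AbelianGroupProperties
import Algebra.Properties.CommutativeSemigroup as CommutativeSemigroupProperties
import Algebra.Properties.Monoid.Sum as MonoidSum
import Algebra.Properties.Ring as RingProperties
open import Data.Bool using (Bool; true; false; _∧_; if_then_else_)
open import Data.Fin using (Fin; toℕ; fromℕ; inject₁)
open import Data.Fin.Properties using (toℕ-fromℕ; toℕ-inject₁)
open import Data.Integer using (+_)
open import Data.Nat as ℕ using (ℕ; zero; suc)
import Data.Nat.Properties as ℕ
open import Data.Product using (_×_; _,_; proj₁; proj₂; ∃)
open import Data.Rational as ℚ using (ℚ; 0ℚ; 1ℚ; ½)
import Data.Rational.Properties as ℚ
open import Level using (0ℓ)
open import Relation.Binary.Bundles using (Setoid)
open import Relation.Binary.PropositionalEquality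
  using (_≡_; refl; sym; trans; cong; cong₂; subst)
import Relation.Binary.Reasoning.Setoid as SetoidReasoning
open import Relation.Nullary using (¬_; Dec; yes; no; does)
open import Relation.Nullary.Decidable using (decidable-stable)
open import Relation.Nullary.Negation using (¬¬-map)

open AbelianGroupProperties ℚ.+-0-abelianGroup
  using (//-rightDividesˡ; ⁻¹-anti-homo-//; ⁻¹-∙-comm)
open RingProperties ℚ.+-*-ring using (x[y-z]≈xy-xz)
open CommutativeSemigroupProperties
  (CommutativeMonoid.commutativeSemigroup ℚ.+-0-commutativeMonoid) using (interchange)

-- Null sequences of rationals.

Null : (ℕ → ℚ) → Set
Null z = ∀ ε → 0ℚ ℚ.< ε → Eventually λ n → ℚ.∣ z n ∣ ℚ.< ε

½-pos : ∀ {ε} → 0ℚ ℚ.< ε → 0ℚ ℚ.< ½ ℚ.* ε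
½-pos {ε} ε>0 =
  subst (ℚ._< ½ ℚ.* ε) (ℚ.*-zeroʳ ½) (ℚ.*-monoʳ-<-pos ½ ε>0)

∣p+q∣<ε : ∀ p q {ε} → ℚ.∣ p ∣ ℚ.< ½ ℚ.* ε → ℚ.∣ q ∣ ℚ.< ½ ℚ.* ε → ℚ.∣ p ℚ.+ q ∣ ℚ.< ε
∣p+q∣<ε p q {ε} p< q< = subst (ℚ.∣ p ℚ.+ q ∣ ℚ.<_)
  (trans (sym (ℚ.*-distribʳ-+ ε ½ ½)) (ℚ.*-identityˡ ε))
  (ℚ.≤-<-trans (ℚ.∣p+q∣≤∣p∣+∣q∣ p q) (ℚ.+-mono-< p< q<))

-- By definition `x ≃ y` says that the termwise difference is `Null`, so each law of `≃` below is a
-- closure property of null sequences followed by a rational identity applied through this lemma.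
Null-resp : ∀ {y z} → (∀ n → y n ≡ z n) → Null y → Null z
Null-resp y≡z null ε ε>0 with N , small ← null ε ε>0 =
  N , λ n n≥ → subst (λ q → ℚ.∣ q ∣ ℚ.< ε) (y≡z n) (small n n≥)

Null-+ : ∀ {y z} → Null y → Null z → Null (λ n → y n ℚ.+ z n)
Null-+ {y} {z} null-y null-z ε ε>0
  with N₁ , small-y ← null-y (½ ℚ.* ε) (½-pos ε>0)
     | N₂ , small-z ← null-z (½ ℚ.* ε) (½-pos ε>0) =
  N₁ ℕ.⊔ N₂ , λ n n≥ → ∣p+q∣<ε (y n) (z n)
    (small-y n (ℕ.m⊔n≤o⇒m≤o N₁ N₂ n≥)) (small-z n (ℕ.m⊔n≤o⇒n≤o N₁ N₂ n≥))

Null-neg : ∀ {z} → Null z → Null (λ n → ℚ.- z n)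
Null-neg {z} null ε ε>0 with N , small ← null ε ε>0 =
  N , λ n n≥ → subst (ℚ._< ε) (sym (ℚ.∣-p∣≡∣p∣ (z n))) (small n n≥)

-- Past the Cauchy index for tolerance 1, every term lies within 1 of `seq a N`.
eventually-bounded : ∀ (a : ℝ) →
  ∃ λ B → ℚ.Positive B × Eventually λ n → ℚ.∣ seq a n ∣ ℚ.≤ B
eventually-bounded a with N , near ← cauchy a 1ℚ (ℚ.positive⁻¹ 1ℚ) =
  1ℚ ℚ.+ ℚ.∣ seq a N ∣ ,
  ℚ.positive (ℚ.+-mono-<-≤ (ℚ.positive⁻¹ 1ℚ) (ℚ.0≤∣p∣ (seq a N))) ,
  N , λ n n≥ →
    subst (λ q → ℚ.∣ q ∣ ℚ.≤ 1ℚ ℚ.+ ℚ.∣ seq a N ∣) (//-rightDividesˡ (seq a N) (seq a n))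
      (ℚ.≤-trans (ℚ.∣p+q∣≤∣p∣+∣q∣ (seq a n ℚ.- seq a N) (seq a N))
                 (ℚ.+-monoˡ-≤ ℚ.∣ seq a N ∣ (ℚ.<⇒≤ (near n N n≥ ℕ.≤-refl))))

Null-*ˡ : ∀ (a : ℝ) {z} → Null z → Null (λ n → seq a n ℚ.* z n)
Null-*ˡ a {z} null ε ε>0 with B , B>0 , N₁ , a≤B ← eventually-bounded a =
  -- The tolerance for `z` is scaled by `B⁻¹` to absorb the tail bound `B` on `a`.
  let N₂ , small = null (B⁻¹ ℚ.* ε) δ>0
  in N₁ ℕ.⊔ N₂ , λ n n≥ → begin-strict
    ℚ.∣ seq a n ℚ.* z n ∣          ≡⟨ ℚ.∣p*q∣≡∣p∣*∣q∣ (seq a n) (z n) ⟩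
    ℚ.∣ seq a n ∣ ℚ.* ℚ.∣ z n ∣    ≤⟨ ℚ.*-monoʳ-≤-nonNeg ℚ.∣ z n ∣ {{ℚ.∣-∣-nonNeg (z n)}}
                                        (a≤B n (ℕ.m⊔n≤o⇒m≤o N₁ N₂ n≥)) ⟩
    B ℚ.* ℚ.∣ z n ∣                <⟨ ℚ.*-monoʳ-<-pos B (small n (ℕ.m⊔n≤o⇒n≤o N₁ N₂ n≥)) ⟩
    B ℚ.* (B⁻¹ ℚ.* ε)              ≡⟨ ℚ.*-assoc B B⁻¹ ε ⟨
    B ℚ.* B⁻¹ ℚ.* ε                ≡⟨ cong (ℚ._* ε) (ℚ.*-inverseʳ B) ⟩
    1ℚ ℚ.* ε                       ≡⟨ ℚ.*-identityˡ ε ⟩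
    ε                              ∎
  where
  open ℚ.≤-Reasoning
  instance
    _ = B>0
    _ = ℚ.pos⇒nonZero B
  B⁻¹ = ℚ.1/ B
  instance
    _ = ℚ.1/pos⇒pos B
  δ>0 : 0ℚ ℚ.< B⁻¹ ℚ.* ε
  δ>0 = subst (ℚ._< B⁻¹ ℚ.* ε) (ℚ.*-zeroʳ B⁻¹) (ℚ.*-monoʳ-<-pos B⁻¹ ε>0)

-- Equality of reals as a congruence.

≗⇒≃ : ∀ {x y} → (∀ n → seq x n ≡ seq y n) → x ≃ y
≗⇒≃ {x} {y} x≡y ε ε>0 = 0 , λ n _ → subst (ℚ._< ε)
  (sym (cong ℚ.∣_∣ (trans (cong (ℚ._- seq y n) (x≡y n)) (ℚ.+-inverseʳ (seq y n))))) ε>0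

≃-refl : ∀ {x} → x ≃ x
≃-refl {x} = ≗⇒≃ {x} {x} λ _ → refl

≃-sym : ∀ {x y} → x ≃ y → y ≃ x
≃-sym {x} {y} x≃y = Null-resp
  (λ n → ⁻¹-anti-homo-// (seq x n) (seq y n)) (Null-neg x≃y)

≃-trans : ∀ {x y z} → x ≃ y → y ≃ z → x ≃ z
≃-trans {x} {y} {z} x≃y y≃z = Null-resp
  (λ n → telescope (seq x n) (seq y n) (seq z n)) (Null-+ x≃y y≃z)
  where
  telescope : ∀ p q r → (p ℚ.- q) ℚ.+ (q ℚ.- r) ≡ p ℚ.- r
  telescope p q r = trans (sym (ℚ.+-assoc (p ℚ.- q) q (ℚ.- r)))
                          (cong (ℚ._- r) (//-rightDividesˡ q p))

≃-setoid : Setoid 0ℓ 0ℓ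
≃-setoid = record
  { Carrier = ℝ
  ; _≈_ = _≃_
  ; isEquivalence = record
    { refl  = λ {x} → ≃-refl {x}
    ; sym   = λ {x} {y} → ≃-sym {x} {y}
    ; trans = λ {x} {y} {z} → ≃-trans {x} {y} {z}
    }
  }

-- A double negation does not pass through the existential index in `Eventually`. Here the Cauchy
-- property of `x - y` supplies that index in advance; what remains for each `n` is a decidable
-- inequality of rationals, hence stable.
≃-stable : ∀ x y → ¬ ¬ (x ≃ y) → x ≃ y
≃-stable x y ¬¬x≃y ε ε>0 with N , near ← cauchy (x - y) (½ ℚ.* ε) (½-pos ε>0) =
  N , λ n n≥ → decidable-stable (_ ℚ.<? _) (¬¬-map (close n n≥) ¬¬x≃y)
  where
  d = seq (x - y)
  close : ∀ n → N ℕ.≤ n → x ≃ y → ℚ.∣ d n ∣ ℚ.< ε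
  close n n≥ x≃y with M , small ← x≃y (½ ℚ.* ε) (½-pos ε>0) =
    -- At this `m` the difference is small and also close to its value at `n`, which gives half of
    -- `ε` each.
    let m = N ℕ.⊔ M
    in subst (λ q → ℚ.∣ q ∣ ℚ.< ε) (//-rightDividesˡ (d m) (d n))
         (∣p+q∣<ε (d n ℚ.- d m) (d m)
           (near n m n≥ (ℕ.m≤m⊔n N M)) (small m (ℕ.m≤n⊔m N M)))

+-cong : ∀ {x y u v} → x ≃ y → u ≃ v → x + u ≃ y + v
+-cong {x} {y} {u} {v} x≃y u≃v = Null-resp
  (λ n → exchange (seq x n) (seq y n) (seq u n) (seq v n)) (Null-+ x≃y u≃v)
  where
  exchange : ∀ a b c d → (a ℚ.- b) ℚ.+ (c ℚ.- d) ≡ (a ℚ.+ c) ℚ.- (b ℚ.+ d)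
  exchange a b c d = trans (interchange a (ℚ.- b) c (ℚ.- d))
                           (cong (a ℚ.+ c ℚ.+_) (⁻¹-∙-comm b d))

*-congˡ : ∀ a {x y} → x ≃ y → a * x ≃ a * y
*-congˡ a {x} {y} x≃y = Null-resp
  (λ n → x[y-z]≈xy-xz (seq a n) (seq x n) (seq y n)) (Null-*ˡ a x≃y)

*-comm : ∀ x y → x * y ≃ y * x
*-comm x y = ≗⇒≃ {x * y} {y * x} λ n → ℚ.*-comm (seq x n) (seq y n)

*-congʳ : ∀ a {x y} → x ≃ y → x * a ≃ y * a
*-congʳ a {x} {y} x≃y = begin
  x * a  ≈⟨ *-comm x a ⟩
  a * x  ≈⟨ *-congˡ a {x} {y} x≃y ⟩
  a * y  ≈⟨ *-comm a y ⟩
  y * a  ∎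
  where open SetoidReasoning ≃-setoid

-- Its underlying raw monoid is `+-rawMonoid`, so general facts on monoid sums apply to `sum`.
+-0-monoid : Monoid 0ℓ 0ℓ
+-0-monoid = record
  { Carrier = ℝ
  ; _≈_ = _≃_
  ; _∙_ = _+_
  ; ε = 0ℝ
  ; isMonoid = record
    { isSemigroup = record
      { isMagma = record
        { isEquivalence = Setoid.isEquivalence ≃-setoid
        ; ∙-cong = λ {x} {y} {u} {v} → +-cong {x} {y} {u} {v}
        }
      ; assoc = λ x y z → ≗⇒≃ {(x + y) + z} {x + (y + z)}
                  λ n → ℚ.+-assoc (seq x n) (seq y n) (seq z n)
      }
    ; identity = (λ x → ≗⇒≃ {0ℝ + x} {x} λ n → ℚ.+-identityˡ (seq x n))
               , (λ x → ≗⇒≃ {x + 0ℝ} {x} λ n → ℚ.+-identityʳ (seq x n))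
    }
  }

-- Finite sums and the effect of a push on one node.

open MonoidSum +-0-monoid using (sum-cong-≋; sum-cong-≗; sum-init-last)

*-zeroʳ : ∀ x → x * 0ℝ ≃ 0ℝ
*-zeroʳ x = ≗⇒≃ {x * 0ℝ} {0ℝ} λ n → ℚ.*-zeroʳ (seq x n)

*-zeroˡ : ∀ x → 0ℝ * x ≃ 0ℝ
*-zeroˡ x = ≗⇒≃ {0ℝ * x} {0ℝ} λ n → ℚ.*-zeroˡ (seq x n)

-- `sum` unfolds at its first term, while `π` grows at its last. Indexing `f` by naturals lets both
-- sides use the same function once `inject₁` is erased.
sum-snoc : ∀ m (f : ℕ → ℝ) →
  sum {suc m} (λ k → f (toℕ k)) ≃ sum {m} (λ k → f (toℕ k)) + f m
sum-snoc m f = begin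
  sum {suc m} (λ k → f (toℕ k))
    ≈⟨ sum-init-last {m} (λ k → f (toℕ k)) ⟩
  sum {m} (λ k → f (toℕ (inject₁ k))) + f (toℕ (fromℕ m))
    ≡⟨ cong₂ _+_ (sum-cong-≗ {m} λ k → cong f (toℕ-inject₁ k)) (cong f (toℕ-fromℕ m)) ⟩
  sum {m} (λ k → f (toℕ k)) + f m
    ∎
  where open SetoidReasoning ≃-setoid

-- With `w` the inverse out-degree, the last factor is an entry of `P`. The decision matters only
-- for how the term is computed: an inactive node has `r ≃ 0ℝ` by stability, so its product vanishes
-- too.
push-contribution : ∀ c r w (active? : Dec (¬ (r ≃ 0ℝ))) (e : Bool) →
  (if does active? ∧ e then (c * r) * w else 0ℝ) ≃ (c * r) * (if e then 1ℝ * w else 0ℝ)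
push-contribution c r w (yes _) true =
  ≗⇒≃ {(c * r) * w} {(c * r) * (1ℝ * w)} λ n →
    cong (seq (c * r) n ℚ.*_) (sym (ℚ.*-identityˡ (seq w n)))
push-contribution c r w (yes _) false =
  ≃-sym {(c * r) * 0ℝ} {0ℝ} (*-zeroʳ (c * r))
push-contribution c r w (no ¬active) e = begin
  0ℝ            ≈⟨ *-zeroˡ p ⟨
  0ℝ * p        ≈⟨ *-congʳ p {c * 0ℝ} {0ℝ} (*-zeroʳ c) ⟨
  (c * 0ℝ) * p  ≈⟨ *-congʳ p {c * r} {c * 0ℝ} (*-congˡ c {r} {0ℝ} (≃-stable r 0ℝ ¬active)) ⟨
  (c * r) * p   ∎
  where
  open SetoidReasoning ≃-setoid
  p = if e then 1ℝ * w else 0ℝ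

push-reserve : ∀ a q r (active? : Dec (¬ (r ≃ 0ℝ))) →
  (if does active? then q + a * r else q) ≃ q + a * r
push-reserve a q r (yes _) = ≃-refl {q + a * r}
push-reserve a q r (no ¬active) = begin
  q           ≈⟨ Monoid.identityʳ +-0-monoid q ⟨
  q + 0ℝ      ≈⟨ +-cong {q} {q} {a * 0ℝ} {0ℝ} (≃-refl {q}) (*-zeroʳ a) ⟨
  q + a * 0ℝ  ≈⟨ +-cong {q} {q} {a * r} {a * 0ℝ} (≃-refl {q})
                   (*-congˡ a {r} {0ℝ} (≃-stable r 0ℝ ¬active)) ⟨
  q + a * r   ∎
  where open SetoidReasoning ≃-setoid

-- Comparison of the two procedures along a run.

module _ {n : ℕ} (G : Digraph n) (deg≥1 : ∀ v → 1 ℕ.≤ Digraph.outDegree G v)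
         (s : Fin n) (α : ℝ) where

  open Digraph G
  open PPR G deg≥1 s α
  open SetoidReasoning ≃-setoid

  -- Division by `outDegree v` unfolds to multiplication by this real, both in a push and in `P`.
  inverseDegree : Fin n → ℝ
  inverseDegree v = fromℚ (ℚ._/_ (+ 1) (outDegree v) {{ℕ.>-nonZero (deg≥1 v)}})

  π-suc : ∀ j v → π (suc j) v ≃ π j v + α * γ j v
  -- `π zero` has its own clause; it agrees with the empty sum by computation.
  π-suc zero    v = sum-snoc zero λ k → α * γ k v
  π-suc (suc j) v = sum-snoc (suc j) λ k → α * γ k v

  -- Induction on the run, started at iteration 0, where both procedures hold the same vectors. The
  -- residue and reserve equalities are carried together, since the reserve update uses the old
  -- residue.
  SimFwdPush≈PowItr : ∀ {j σ} → SimFwdPush j σ →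
    (residue σ ≈ᵥ γ j) × (reserve σ ≈ᵥ π j)
  SimFwdPush≈PowItr initially =
    (λ v → ≃-refl {indicator s v}) , (λ v → ≃-refl {0ℝ})
  SimFwdPush≈PowItr (iterate {j} {σ} run active?) = residue-eq , reserve-eq
    where
    r≈γ = proj₁ (SimFwdPush≈PowItr run)
    q≈π = proj₂ (SimFwdPush≈PowItr run)
    c = 1ℝ - α
    σ′ = pushActive σ active?

    residue-eq : residue σ′ ≈ᵥ γ (suc j)
    -- The scalar acts before `P` in `γ (suc j)`, so both sides are sums over `v` and can be
    -- compared term by term.
    residue-eq u = sum-cong-≋ {n} λ v → begin
      (if does (active? v) ∧ edge v u then (c * residue σ v) * inverseDegree v else 0ℝ)
        ≈⟨ push-contribution c (residue σ v) (inverseDegree v) (active? v) (edge v u) ⟩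
      (c * residue σ v) * P v u
        ≈⟨ *-congʳ (P v u) {c * residue σ v} {c * γ j v}
             (*-congˡ c {residue σ v} {γ j v} (r≈γ v)) ⟩
      (c * γ j v) * P v u
        ∎

    reserve-eq : reserve σ′ ≈ᵥ π (suc j)
    reserve-eq v = begin
      reserve σ′ v
        ≈⟨ push-reserve α (reserve σ v) (residue σ v) (active? v) ⟩
      reserve σ v + α * residue σ v
        ≈⟨ +-cong {reserve σ v} {π j v} {α * residue σ v} {α * γ j v} (q≈π v)
             (*-congˡ α {residue σ v} {γ j v} (r≈γ v)) ⟩
      π j v + α * γ j v
        ≈⟨ π-suc j v ⟨
      π (suc j) v
        ∎

lemma4p1 : ∀ {n : ℕ} (G : Digraph n) (deg≥1 : ∀ v → 1 ℕ.≤ Digraph.outDegree G v)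
    (s : Fin n) (α : ℝ) → 0ℝ ≤ α → α < 1ℝ →
    let open PPR G deg≥1 s α in
    ∀ (j : ℕ) (σ : State) → SimFwdPush (suc j) σ →
    (residue σ ≈ᵥ γ (suc j)) × (reserve σ ≈ᵥ π (suc j))
lemma4p1 G deg≥1 s α _ _ j σ run = SimFwdPush≈PowItr G deg≥1 s α run
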